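{- Any satisfiable $d$-dim linear system $S$ has a solution $x\in\mathbb{Z}^d$ such that $\|x\|_1\leq \mathrm{lcm}(S)\cdot\left(d+\left(2+d+d^{2}\cdot\|S\|\right)^{2d+1}\right)$.
   Context: For a variable $\mathbf{x}$ ranging over $\mathbb{Z}^d$: an equality constraint is $\langle\alpha,\mathbf{x}\rangle=c$ and an inequality constraint is $\langle\alpha,\mathbf{x}\rangle\geq c$, with $\alpha\in\mathbb{Z}^d$, $c\in\mathbb{Z}$; a divisibility constraint is $\langle\alpha,\mathbf{x}\rangle\equiv c \pmod m$ with $m\in\mathbb{N}_+$, $\alpha\in[0,m-1]^d$, $c\in[0,m-1]$. A $d$-dim linear system $S$ is a propositional formula (boolean combination) whose atoms are such constraints for the fixed variable $\mathbf{x}$; its solutions are the $x\in\mathbb{Z}^d$ satisfying it, and $S$ is satisfiable if it has a solution. $\|S\|$ is the least $s\in\mathbb{N}$ with $\max\{\|\alpha\|,|c|\}\leq s$ for all equality and inequality constraints in $S$ (where $\|\alpha\|=\max_i|\alpha(i)|$), and $\mathrm{lcm}(S)$ is the least common multiple of all moduli $m$ of divisibility constraints in $S$ (equal to $1$ if there are none). $\|x\|_1=\sum_i|x(i)|$. -}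

module Defs where

open import Algebra.Definitions.RawMonoid using (sum)
open import Data.Empty using (⊥)
open import Data.Fin.Base using (Fin; toℕ)
open import Data.Integer.Base as ℤ using (ℤ; +_; ∣_∣)
open import Data.Integer.Divisibility.Signed using () renaming (_∣_ to _∣ℤ_)
open import Data.List.Base using (List; []; _∷_; [_]; _++_; foldr; map)
open import Data.List.Relation.Unary.All using (All; []; _∷_)
open import Data.Nat.Base as ℕ using (ℕ; NonZero; _⊔_; _≤_; z≤n)
open import Data.Nat.Divisibility using (_∣_; 1∣_; ∣-trans)
import Data.Nat.LCM as ℕ
import Data.Nat.Properties as ℕ
import Data.Integer.Properties as ℤ
open import Data.Product.Base using (∃; _×_; _,_)
open import Data.Sum.Base using (_⊎_)
open import Data.Unit.Base using (⊤; tt)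
open import Data.Vec.Functional as Vector using (Vector)
open import Function.Base using (_∘_)
open import Function.Bundles using (_⇔_; mk⇔)
open import Relation.Binary.PropositionalEquality.Core using (_≡_)
open import Relation.Nullary.Negation.Core using (¬_)

private
  variable
    d : ℕ

------------------------------------------------------------------------
-- Integer vectors

⟨_,_⟩ : Vector ℤ d → Vector ℤ d → ℤ
⟨ α , x ⟩ = sum ℤ.+-0-rawMonoid (λ i → α i ℤ.* x i)

‖_‖₁ : Vector ℤ d → ℕ
‖ x ‖₁ = sum ℕ.+-0-rawMonoid (∣_∣ ∘ x)

‖_‖∞ : Vector ℤ d → ℕ
‖ α ‖∞ = Vector.foldr _⊔_ 0 (∣_∣ ∘ α)

_≡_mod_ : ℤ → ℤ → ℕ → Set
i ≡ j mod m = + m ∣ℤ i ℤ.- j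

------------------------------------------------------------------------
-- Linear systems

-- Fin m is the range [0, m-1].
data Constraint (d : ℕ) : Set where
  equality     : (α : Vector ℤ d) (c : ℤ) → Constraint d
  inequality   : (α : Vector ℤ d) (c : ℤ) → Constraint d
  divisibility : (m : ℕ) .{{_ : NonZero m}} (α : Vector (Fin m) d) (c : Fin m) →
                 Constraint d

infixr 7 _∧′_
infixr 6 _∨′_

data System (d : ℕ) : Set where
  atom      : Constraint d → System d
  ⊤′ ⊥′     : System d
  ¬′_       : System d → System d
  _∧′_ _∨′_ : System d → System d → System d

Holds : Vector ℤ d → Constraint d → Set
Holds x (equality α c)       = ⟨ α , x ⟩ ≡ c
Holds x (inequality α c)     = ⟨ α , x ⟩ ℤ.≥ c
Holds x (divisibility m α c) = ⟨ +_ ∘ toℕ ∘ α , x ⟩ ≡ + toℕ c mod m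

-- All constraints are decidable, so the constructive connectives used
-- here agree with the classical truth-table semantics.
infix 4 _⊨_

_⊨_ : Vector ℤ d → System d → Set
x ⊨ atom a  = Holds x a
x ⊨ ⊤′      = ⊤
x ⊨ ⊥′      = ⊥
x ⊨ ¬′ S    = ¬ (x ⊨ S)
x ⊨ S ∧′ T  = (x ⊨ S) × (x ⊨ T)
x ⊨ S ∨′ T  = (x ⊨ S) ⊎ (x ⊨ T)

Satisfiable : System d → Set
Satisfiable S = ∃ λ x → x ⊨ S

constraints : System d → List (Constraint d)
constraints (atom a)  = [ a ]
constraints ⊤′        = []
constraints ⊥′        = []
constraints (¬′ S)    = constraints S
constraints (S ∧′ T)  = constraints S ++ constraints T
constraints (S ∨′ T)  = constraints S ++ constraints T

------------------------------------------------------------------------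
-- Norm and least common multiple of a system

-- Divisibility constraints do not contribute to the norm: 0 is neutral
-- for _⊔_.
size : Constraint d → ℕ
size (equality α c)       = ‖ α ‖∞ ⊔ ∣ c ∣
size (inequality α c)     = ‖ α ‖∞ ⊔ ∣ c ∣
size (divisibility _ _ _) = 0

‖_‖ : System d → ℕ
‖ S ‖ = foldr _⊔_ 0 (map size (constraints S))

-- Only divisibility constraints contribute to the lcm: 1 is neutral
-- for lcm.
modulus : Constraint d → ℕ
modulus (equality _ _)       = 1
modulus (inequality _ _)     = 1
modulus (divisibility m _ _) = m

lcm : System d → ℕ
lcm S = foldr ℕ.lcm 1 (map modulus (constraints S))

------------------------------------------------------------------------
-- ‖ S ‖ is the least s bounding all coefficients of equality and
-- inequality constraints, and lcm S is the least (for divisibility)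
-- common multiple of the moduli of divisibility constraints.

BoundedBy : ℕ → Constraint d → Set
BoundedBy s (equality α c)       = ‖ α ‖∞ ⊔ ∣ c ∣ ≤ s
BoundedBy s (inequality α c)     = ‖ α ‖∞ ⊔ ∣ c ∣ ≤ s
BoundedBy s (divisibility _ _ _) = ⊤

ModulusDivides : ℕ → Constraint d → Set
ModulusDivides n (equality _ _)       = ⊤
ModulusDivides n (inequality _ _)     = ⊤
ModulusDivides n (divisibility m _ _) = m ∣ n

‖‖-least : (S : System d) (s : ℕ) →
           ‖ S ‖ ≤ s ⇔ All (BoundedBy s) (constraints S)
‖‖-least S s = mk⇔ (to (constraints S)) from
  where
  to₁ : ∀ a → size a ≤ s → BoundedBy s a
  to₁ (equality _ _)       p = p
  to₁ (inequality _ _)     p = p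
  to₁ (divisibility _ _ _) _ = tt

  from₁ : ∀ a → BoundedBy s a → size a ≤ s
  from₁ (equality _ _)       p = p
  from₁ (inequality _ _)     p = p
  from₁ (divisibility _ _ _) _ = z≤n

  to : ∀ as → foldr _⊔_ 0 (map size as) ≤ s → All (BoundedBy s) as
  to []       _ = []
  to (a ∷ as) p = to₁ a (ℕ.m⊔n≤o⇒m≤o (size a) _ p) ∷
                  to as (ℕ.m⊔n≤o⇒n≤o (size a) _ p)

  from : ∀ {as} → All (BoundedBy s) as → foldr _⊔_ 0 (map size as) ≤ s
  from []       = z≤n
  from (p ∷ ps) = ℕ.⊔-lub (from₁ _ p) (from ps)

lcm-least : (S : System d) (n : ℕ) →
            lcm S ∣ n ⇔ All (ModulusDivides n) (constraints S)
lcm-least S n = mk⇔ (to (constraints S)) from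
  where
  to₁ : ∀ a → modulus a ∣ n → ModulusDivides n a
  to₁ (equality _ _)       _ = tt
  to₁ (inequality _ _)     _ = tt
  to₁ (divisibility _ _ _) p = p

  from₁ : ∀ a → ModulusDivides n a → modulus a ∣ n
  from₁ (equality _ _)       _ = 1∣ n
  from₁ (inequality _ _)     _ = 1∣ n
  from₁ (divisibility _ _ _) p = p

  to : ∀ as → foldr ℕ.lcm 1 (map modulus as) ∣ n → All (ModulusDivides n) as
  to []       _ = []
  to (a ∷ as) p = to₁ a (∣-trans (ℕ.m∣lcm[m,n] (modulus a) _) p) ∷
                  to as (∣-trans (ℕ.n∣lcm[m,n] (modulus a) _) p)

  from : ∀ {as} → All (ModulusDivides n) as → foldr ℕ.lcm 1 (map modulus as) ∣ n
  from []       = 1∣ n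
  from (p ∷ ps) = ℕ.lcm-least (from₁ _ p) (from ps)

{-# OPTIONS --safe #-}

-- Let L = lcm S, and let x be a solution for which the vector of
-- the ∣ x i ∣ is lexicographically minimal. Adding L v to x cannot affect
-- divisibility constraints, and it leaves the truth value of any other constraint
-- ⟨ α , x ⟩ ≥ c or ⟨ α , x ⟩ = c unchanged if ⟨ α , v ⟩ = 0 or if
-- ⟨ α , x ⟩ - c exceeds L ∣⟨ α , v ⟩∣ in absolute value. Consider the rows α for
-- which ⟨ α , x ⟩ - c is small; each coordinate x i, with c = 0, is treated like
-- one more constraint. If these rows have rank less than d, then by Siegel's
-- pigeonhole argument they have a small common kernel vector v ≠ 0, and x + L v or
-- x - L v is a lexicographically smaller solution. So they have rank d, and a second
-- application of Siegel's argument writes a multiple of each x i as a combination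
-- of d values ⟨ α , x ⟩ with small coefficients, which bounds ∣ x i ∣.

module Submission where

open import Defs
open import Algebra.Bundles using (module AbelianGroup)
open import Data.Fin.Base as Fin using (Fin; zero; suc; toℕ; fromℕ<; finToFun; funToFin)
import Data.Fin.Properties as Fin
open import Data.Integer.Base as ℤ using (ℤ; +_; -[1+_]; 0ℤ; 1ℤ; ∣_∣; +≤+)
import Data.Integer.DivMod as ℤ
open import Data.Integer.Divisibility.Signed as Signed using () renaming (_∣_ to _∣ℤ_)
import Data.Integer.Properties as ℤ
import Data.Integer.Tactic.RingSolver as ℤ-Solver
open import Data.List.Base as List using (List; []; _∷_; _++_)
open import Data.List.Relation.Unary.All as All using (All; []; _∷_)
import Data.List.Relation.Unary.All.Properties as All
open import Data.Nat.Base as ℕ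
  using (ℕ; zero; suc; _+_; _*_; _^_; _∸_; _≤_; _<_; z≤n; s≤s; NonZero)
import Data.Nat.Divisibility as ℕ
import Data.Nat.Induction as ℕ
import Data.Nat.LCM as ℕ
import Data.Nat.Properties as ℕ
import Data.Nat.Tactic.RingSolver as ℕ-Solver
open import Data.Product.Base using (∃; ∃₂; _×_; _,_; proj₁; proj₂)
open import Data.Sum.Base as Sum using (_⊎_; inj₁; inj₂)
open import Data.Vec.Functional as Vector using (Vector)
open import Data.Vec.Relation.Binary.Lex.Strict as Lex using (Lex-<; this; next)
open import Function.Base using (_∘_; id)
open import Function.Bundles using (_⇔_; mk⇔; module Equivalence)
import Function.Construct.Identity as Identity
open import Induction.WellFounded using (WellFounded; Acc; acc)
import Relation.Binary.Construct.On as On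
open import Relation.Binary.PropositionalEquality
open import Relation.Nullary.Decidable using (yes; no; ¬?; _×-dec_; decidable-stable)
open import Relation.Nullary.Negation.Core using (¬_; contradiction)

open import Algebra.Properties.Group (AbelianGroup.group ℤ.+-0-abelianGroup)
  using (∙-cancelʳ)
import Algebra.Properties.Semiring.Sum ℤ.+-*-semiring as ℤΣ

open Equivalence using (to; from)

private
  variable
    d k n : ℕ

-- The integer pairing: linearity and norm estimates

⟨⟩-congʳ : (α : Vector ℤ d) {x y : Vector ℤ d} → x ≗ y → ⟨ α , x ⟩ ≡ ⟨ α , y ⟩
⟨⟩-congʳ α x≗y = ℤΣ.sum-cong-≗ (λ i → cong (α i ℤ.*_) (x≗y i))

⟨⟩-congˡ : {α β : Vector ℤ d} (x : Vector ℤ d) → α ≗ β → ⟨ α , x ⟩ ≡ ⟨ β , x ⟩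
⟨⟩-congˡ x α≗β = ℤΣ.sum-cong-≗ (λ i → cong (ℤ._* x i) (α≗β i))

⟨⟩-comm : (α x : Vector ℤ d) → ⟨ α , x ⟩ ≡ ⟨ x , α ⟩
⟨⟩-comm α x = ℤΣ.sum-cong-≗ (λ i → ℤ.*-comm (α i) (x i))

⟨⟩-+ : (α x y : Vector ℤ d) →
       ⟨ α , (λ i → x i ℤ.+ y i) ⟩ ≡ ⟨ α , x ⟩ ℤ.+ ⟨ α , y ⟩
⟨⟩-+ α x y = trans
  (ℤΣ.sum-cong-≗ (λ i → ℤ.*-distribˡ-+ (α i) (x i) (y i)))
  (ℤΣ.∑-distrib-+ (λ i → α i ℤ.* x i) (λ i → α i ℤ.* y i))

⟨⟩-* : (α : Vector ℤ d) (c : ℤ) (x : Vector ℤ d) →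
       ⟨ α , (λ i → c ℤ.* x i) ⟩ ≡ c ℤ.* ⟨ α , x ⟩
⟨⟩-* α c x = trans
  (ℤΣ.sum-cong-≗ (λ i → swap (α i) c (x i)))
  (sym (ℤΣ.*-distribˡ-sum c (λ i → α i ℤ.* x i)))
  where
  swap : ∀ a b e → a ℤ.* (b ℤ.* e) ≡ b ℤ.* (a ℤ.* e)
  swap = ℤ-Solver.solve-∀

⟨⟩-neg : (α x : Vector ℤ d) → ⟨ α , ℤ.-_ ∘ x ⟩ ≡ ℤ.- ⟨ α , x ⟩
⟨⟩-neg α x = begin
  ⟨ α , ℤ.-_ ∘ x ⟩                   ≡⟨ ⟨⟩-congʳ α (λ i → ℤ.-1*i≡-i (x i)) ⟨
  ⟨ α , (λ i → ℤ.-1ℤ ℤ.* x i) ⟩      ≡⟨ ⟨⟩-* α ℤ.-1ℤ x ⟩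
  ℤ.-1ℤ ℤ.* ⟨ α , x ⟩                ≡⟨ ℤ.-1*i≡-i _ ⟩
  ℤ.- ⟨ α , x ⟩                      ∎
  where open ≡-Reasoning

⟨⟩-- : (α x y : Vector ℤ d) →
       ⟨ α , (λ i → x i ℤ.- y i) ⟩ ≡ ⟨ α , x ⟩ ℤ.- ⟨ α , y ⟩
⟨⟩-- α x y = trans (⟨⟩-+ α x (ℤ.-_ ∘ y)) (cong (ℤ._+_ ⟨ α , x ⟩) (⟨⟩-neg α y))

⟨⟩-zeroˡ : (x : Vector ℤ d) → ⟨ (λ _ → 0ℤ) , x ⟩ ≡ 0ℤ
⟨⟩-zeroˡ {d} x = trans (ℤΣ.sum-cong-≗ (λ i → ℤ.*-zeroˡ (x i))) (ℤΣ.sum-replicate-zero d)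

⟨⟩-zeroʳ : (α : Vector ℤ d) → ⟨ α , (λ _ → 0ℤ) ⟩ ≡ 0ℤ
⟨⟩-zeroʳ {d} α = trans (ℤΣ.sum-cong-≗ (λ i → ℤ.*-zeroʳ (α i))) (ℤΣ.sum-replicate-zero d)

-- Exchanging the two summations carries a relation among rows over to their values at any vector.
⟨⟩-assoc : (μ : Vector ℤ k) (F : Vector (Vector ℤ d) k) (x : Vector ℤ d) →
           ⟨ μ , (λ i → ⟨ F i , x ⟩) ⟩ ≡ ⟨ (λ l → ⟨ μ , (λ i → F i l) ⟩) , x ⟩
⟨⟩-assoc μ F x = begin
  ⟨ μ , (λ i → ⟨ F i , x ⟩) ⟩
    ≡⟨ ℤΣ.sum-cong-≗ (λ i → ℤΣ.*-distribˡ-sum (μ i) (λ l → F i l ℤ.* x l)) ⟩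
  ℤΣ.sum (λ i → ℤΣ.sum (λ l → μ i ℤ.* (F i l ℤ.* x l)))
    ≡⟨ ℤΣ.∑-comm (λ i l → μ i ℤ.* (F i l ℤ.* x l)) ⟩
  ℤΣ.sum (λ l → ℤΣ.sum (λ i → μ i ℤ.* (F i l ℤ.* x l)))
    ≡⟨ ℤΣ.sum-cong-≗ (λ l → ℤΣ.sum-cong-≗ (λ i → ℤ.*-assoc (μ i) (F i l) (x l))) ⟨
  ℤΣ.sum (λ l → ℤΣ.sum (λ i → μ i ℤ.* F i l ℤ.* x l))
    ≡⟨ ℤΣ.sum-cong-≗ (λ l → ℤΣ.*-distribʳ-sum (x l) (λ i → μ i ℤ.* F i l)) ⟨
  ⟨ (λ l → ⟨ μ , (λ i → F i l) ⟩) , x ⟩ ∎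
  where open ≡-Reasoning

‖‖₁-≤ : (x : Vector ℤ n) (C : ℕ) → (∀ i → ∣ x i ∣ ≤ C) → ‖ x ‖₁ ≤ n * C
‖‖₁-≤ {zero}  x C x≤C = z≤n
‖‖₁-≤ {suc n} x C x≤C = ℕ.+-mono-≤ (x≤C zero) (‖‖₁-≤ (x ∘ suc) C (x≤C ∘ suc))

∣⟨⟩∣≤ : (α x : Vector ℤ n) (C : ℕ) → (∀ i → ∣ α i ∣ * ∣ x i ∣ ≤ C) → ∣ ⟨ α , x ⟩ ∣ ≤ n * C
∣⟨⟩∣≤ {zero}  α x C _  = z≤n
∣⟨⟩∣≤ {suc n} α x C le = ℕ.≤-trans
  (ℤ.∣i+j∣≤∣i∣+∣j∣ (α zero ℤ.* x zero) ⟨ α ∘ suc , x ∘ suc ⟩)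
  (ℕ.+-mono-≤ (subst (_≤ C) (sym (ℤ.∣i*j∣≡∣i∣*∣j∣ (α zero) (x zero))) (le zero))
              (∣⟨⟩∣≤ (α ∘ suc) (x ∘ suc) C (le ∘ suc)))

lookup≤‖‖∞ : (α : Vector ℤ n) (i : Fin n) → ∣ α i ∣ ≤ ‖ α ‖∞
lookup≤‖‖∞ α zero    = ℕ.m≤m⊔n ∣ α zero ∣ _
lookup≤‖‖∞ α (suc i) = ℕ.≤-trans (lookup≤‖‖∞ (α ∘ suc) i) (ℕ.m≤n⊔m ∣ α zero ∣ _)

unit : Fin d → Vector ℤ d
unit zero    zero    = 1ℤ
unit zero    (suc _) = 0ℤ
unit (suc _) zero    = 0ℤ
unit (suc j) (suc l) = unit j l

⟨unit,⟩ : (j : Fin d) (x : Vector ℤ d) → ⟨ unit j , x ⟩ ≡ x j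
⟨unit,⟩ zero x = trans
  (cong₂ ℤ._+_ (ℤ.*-identityˡ (x zero)) (⟨⟩-zeroˡ (x ∘ suc)))
  (ℤ.+-identityʳ (x zero))
⟨unit,⟩ (suc j) x = trans
  (cong₂ ℤ._+_ (ℤ.*-zeroˡ (x zero)) (⟨unit,⟩ j (x ∘ suc)))
  (ℤ.+-identityˡ (x (suc j)))

∣unit∣≤1 : (j l : Fin d) → ∣ unit j l ∣ ≤ 1
∣unit∣≤1 zero    zero    = ℕ.≤-refl
∣unit∣≤1 zero    (suc _) = z≤n
∣unit∣≤1 (suc _) zero    = z≤n
∣unit∣≤1 (suc j) (suc l) = ∣unit∣≤1 j l

-- Small kernel vectors by pigeonhole

-- code N a t = a * t + shift N a is natural and takes values in [0 , N * ∣ a ∣]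
-- for t ≤ N, so that no factor 2 is lost when the images are counted.
code : ℕ → ℤ → ℕ → ℕ
code N (+ a)    t = a * t
code N -[1+ a ] t = suc a * (N ∸ t)

shift : ℕ → ℤ → ℤ
shift N (+ a)    = 0ℤ
shift N -[1+ a ] = + (suc a * N)

code≤ : ∀ N a {t} → t ≤ N → code N a t ≤ N * ∣ a ∣
code≤ N (+ a)    {t} t≤N = subst (a * t ≤_) (ℕ.*-comm a N) (ℕ.*-monoʳ-≤ a t≤N)
code≤ N -[1+ a ] {t} t≤N = subst (suc a * (N ∸ t) ≤_) (ℕ.*-comm (suc a) N)
  (ℕ.*-monoʳ-≤ (suc a) (ℕ.m∸n≤m N t))

+code : ∀ N a {t} → t ≤ N → + code N a t ≡ a ℤ.* + t ℤ.+ shift N a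
+code N (+ a)    {t} t≤N = trans (ℤ.pos-* a t) (sym (ℤ.+-identityʳ _))
+code N -[1+ a ] {t} t≤N = begin
  + (suc a * (N ∸ t))                          ≡⟨ ℤ.pos-* (suc a) (N ∸ t) ⟩
  + suc a ℤ.* + (N ∸ t)                        ≡⟨ cong (+ suc a ℤ.*_) (ℤ.⊖-≥ t≤N) ⟨
  + suc a ℤ.* (N ℤ.⊖ t)                        ≡⟨ cong (+ suc a ℤ.*_) (ℤ.m-n≡m⊖n N t) ⟨
  + suc a ℤ.* (+ N ℤ.- + t)                    ≡⟨ rearrange (+ suc a) (+ N) (+ t) ⟩
  ℤ.- (+ suc a) ℤ.* + t ℤ.+ + suc a ℤ.* + N    ≡⟨ cong (ℤ._+_ (-[1+ a ] ℤ.* + t)) (ℤ.pos-* (suc a) N) ⟨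
  -[1+ a ] ℤ.* + t ℤ.+ + (suc a * N)           ∎
  where
  open ≡-Reasoning
  rearrange : ∀ a n t → a ℤ.* (n ℤ.- t) ≡ ℤ.- a ℤ.* t ℤ.+ a ℤ.* n
  rearrange = ℤ-Solver.solve-∀

codes : ℕ → Vector ℤ n → (Fin n → ℕ) → ℕ
codes {zero}  N α t = 0
codes {suc n} N α t = code N (α zero) (t zero) + codes N (α ∘ suc) (t ∘ suc)

codes≤ : ∀ N (α : Vector ℤ n) t → (∀ i → t i ≤ N) → codes N α t ≤ N * ‖ α ‖₁
codes≤ {zero}  N α t t≤N = z≤n
codes≤ {suc n} N α t t≤N = subst (codes N α t ≤_)
  (sym (ℕ.*-distribˡ-+ N ∣ α zero ∣ ‖ α ∘ suc ‖₁))
  (ℕ.+-mono-≤ (code≤ N (α zero) (t≤N zero)) (codes≤ N (α ∘ suc) (t ∘ suc) (t≤N ∘ suc)))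

+codes : ∀ N (α : Vector ℤ n) t → (∀ i → t i ≤ N) →
         + codes N α t ≡ ⟨ α , +_ ∘ t ⟩ ℤ.+ ℤΣ.sum (shift N ∘ α)
+codes {zero}  N α t t≤N = refl
+codes {suc n} N α t t≤N = begin
  + codes N α t
    ≡⟨ ℤ.pos-+ (code N (α zero) (t zero)) _ ⟩
  + code N (α zero) (t zero) ℤ.+ + codes N (α ∘ suc) (t ∘ suc)
    ≡⟨ cong₂ ℤ._+_ (+code N (α zero) (t≤N zero)) (+codes N (α ∘ suc) (t ∘ suc) (t≤N ∘ suc)) ⟩
  (α zero ℤ.* + t zero ℤ.+ shift N (α zero)) ℤ.+
  (⟨ α ∘ suc , +_ ∘ t ∘ suc ⟩ ℤ.+ ℤΣ.sum (shift N ∘ α ∘ suc))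
    ≡⟨ interchange (α zero ℤ.* + t zero) (shift N (α zero)) _ _ ⟩
  ⟨ α , +_ ∘ t ⟩ ℤ.+ ℤΣ.sum (shift N ∘ α) ∎
  where
  open ≡-Reasoning
  interchange : ∀ a b c e → (a ℤ.+ b) ℤ.+ (c ℤ.+ e) ≡ (a ℤ.+ c) ℤ.+ (b ℤ.+ e)
  interchange = ℤ-Solver.solve-∀

-- The sum of shifts does not depend on the point, so it cancels; the difference of points with
-- equal codes is then orthogonal to `α`.
codes-injective : ∀ N (α : Vector ℤ n) {t u} → (∀ i → t i ≤ N) → (∀ i → u i ≤ N) →
                  codes N α t ≡ codes N α u → ⟨ α , +_ ∘ t ⟩ ≡ ⟨ α , +_ ∘ u ⟩
codes-injective N α {t} {u} t≤N u≤N eq = ∙-cancelʳ (ℤΣ.sum (shift N ∘ α)) _ _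
  (trans (sym (+codes N α t t≤N)) (trans (cong +_ eq) (+codes N α u u≤N)))

funToFin-cong : {f g : Fin k → Fin n} → f ≗ g → funToFin f ≡ funToFin g
funToFin-cong {zero}  f≗g = refl
funToFin-cong {suc k} f≗g = cong₂ Fin.combine (f≗g zero) (funToFin-cong (f≗g ∘ suc))

^-distribʳ-* : ∀ m n k → (m * n) ^ k ≡ m ^ k * n ^ k
^-distribʳ-* m n zero    = refl
^-distribʳ-* m n (suc k) = trans (cong (m * n *_) (^-distribʳ-* m n k))
  (ℕ.[m*n]*[o*p]≡[m*o]*[n*p] m n (m ^ k) (n ^ k))

∣+m-+n∣≤ : ∀ {m n N} → m ≤ N → n ≤ N → ∣ + m ℤ.- + n ∣ ≤ N
∣+m-+n∣≤ {m} {n} m≤N n≤N = subst (_≤ _) (cong ∣_∣ (sym (ℤ.m-n≡m⊖n m n)))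
  (ℕ.≤-trans (ℤ.∣m⊝n∣≤m⊔n m n) (ℕ.⊔-lub m≤N n≤N))

-- The box `[0, N]^n` has `suc N ^ n` points, and each code of a point is below `R * suc N`. The
-- choice `N = R ^ k` leaves fewer possible images than points, and the difference of two colliding
-- points is the kernel vector.
siegel : ∀ R .{{_ : NonZero R}} → k < n → (A : Vector (Vector ℤ n) k) → (∀ i → ‖ A i ‖₁ ≤ R) →
         ∃ λ (v : Vector ℤ n) →
           (∃ λ j → v j ≢ 0ℤ) × (∀ i → ⟨ A i , v ⟩ ≡ 0ℤ) × (∀ j → ∣ v j ∣ ≤ R ^ k)
siegel {k} {n} R k<n A A≤R = v , v≢0 , Av≡0 , v≤N
  where
  N = R ^ k

  point : Fin (suc N ^ n) → Fin n → ℕ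
  point p j = toℕ (finToFun {suc N} {n} p j)

  point≤N : ∀ p j → point p j ≤ N
  point≤N p j = Fin.toℕ≤pred[n] (finToFun {suc N} {n} p j)

  codes<RN : ∀ p i → codes N (A i) (point p) < R * suc N
  codes<RN p i = ℕ.≤-<-trans (codes≤ N (A i) (point p) (point≤N p))
    (ℕ.≤-<-trans (ℕ.*-monoʳ-≤ N (A≤R i))
      -- `R * N < R * suc N` is strict because `R` is nonzero.
      (subst (_< R * suc N) (ℕ.*-comm R N) (ℕ.*-monoʳ-< R ℕ.≤-refl)))

  image : Fin (suc N ^ n) → Fin ((R * suc N) ^ k)
  image p = funToFin (λ i → fromℕ< (codes<RN p i))

  fewer : (R * suc N) ^ k < suc N ^ n
  fewer = begin-strict
    (R * suc N) ^ k     ≡⟨ ^-distribʳ-* R (suc N) k ⟩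
    N * suc N ^ k       <⟨ ℕ.*-monoˡ-< (suc N ^ k) {{ℕ.m^n≢0 (suc N) k}} (ℕ.n<1+n N) ⟩
    suc N ^ suc k       ≤⟨ ℕ.^-monoʳ-≤ (suc N) k<n ⟩
    suc N ^ n           ∎
    where open ℕ.≤-Reasoning

  collision = Fin.pigeonhole fewer image
  p = proj₁ collision
  q = proj₁ (proj₂ collision)
  p<q = proj₁ (proj₂ (proj₂ collision))

  v : Vector ℤ n
  v j = + point p j ℤ.- + point q j

  v≤N : ∀ j → ∣ v j ∣ ≤ N
  v≤N j = ∣+m-+n∣≤ (point≤N p j) (point≤N q j)

  codes≡ : ∀ i → codes N (A i) (point p) ≡ codes N (A i) (point q)
  codes≡ i = Fin.fromℕ<-injective _ _ (codes<RN p i) (codes<RN q i) (begin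
    fromℕ< (codes<RN p i)         ≡⟨ Fin.finToFun-funToFin (λ i → fromℕ< (codes<RN p i)) i ⟨
    finToFun (image p) i          ≡⟨ cong (λ z → finToFun z i) (proj₂ (proj₂ (proj₂ collision))) ⟩
    finToFun (image q) i          ≡⟨ Fin.finToFun-funToFin (λ i → fromℕ< (codes<RN q i)) i ⟩
    fromℕ< (codes<RN q i)         ∎)
    where open ≡-Reasoning

  Av≡0 : ∀ i → ⟨ A i , v ⟩ ≡ 0ℤ
  Av≡0 i = trans (⟨⟩-- (A i) (+_ ∘ point p) (+_ ∘ point q))
    (ℤ.i≡j⇒i-j≡0 (codes-injective N (A i) (point≤N p) (point≤N q) (codes≡ i)))

  p≢q : ¬ (∀ j → finToFun {suc N} {n} p j ≡ finToFun q j)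
  p≢q eq = Fin.<⇒≢ p<q (begin
    p                                   ≡⟨ Fin.funToFin-finToFin {n} p ⟨
    funToFin (finToFun {suc N} {n} p)   ≡⟨ funToFin-cong eq ⟩
    funToFin (finToFun {suc N} {n} q)   ≡⟨ Fin.funToFin-finToFin {n} q ⟩
    q                                   ∎)
    where open ≡-Reasoning

  v≢0 : ∃ λ j → v j ≢ 0ℤ
  v≢0 with j , pj≢qj ← Fin.¬∀⟶∃¬ n _ (λ j → finToFun {suc N} {n} p j Fin.≟ finToFun q j) p≢q =
    j , λ vj≡0 → pj≢qj (Fin.toℕ-injective (ℤ.+-injective (ℤ.i-j≡0⇒i≡j _ _ vj≡0)))

-- Bases of rows

Relation : Vector (Vector ℤ d) k → Vector ℤ k → Set
Relation F μ = ∀ l → ⟨ μ , (λ i → F i l) ⟩ ≡ 0ℤ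

-- The bound N makes independence decidable; it will be taken large enough for
-- the relations found by siegel.
Independent : ℕ → Vector (Vector ℤ d) k → Set
Independent N F = ∀ μ → (∀ i → ∣ μ i ∣ ≤ N) → Relation F μ → ∀ i → μ i ≡ 0ℤ

Dependent : ℕ → Vector (Vector ℤ d) k → Set
Dependent N F = ∃ λ μ → (∀ i → ∣ μ i ∣ ≤ N) × Relation F μ × (∃ λ i → μ i ≢ 0ℤ)

-- Enumerates the interval `[-N, N]`, so that the coefficient vectors allowed in `Independent` can
-- be searched exhaustively.
centre : ∀ N → Fin (suc (N + N)) → ℤ
centre N p = + toℕ p ℤ.- + N

∣centre∣≤ : ∀ N p → ∣ centre N p ∣ ≤ N
∣centre∣≤ N p with ℕ.≤-total N (toℕ p)
... | inj₁ N≤p = subst (_≤ N)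
  (cong ∣_∣ (sym (trans (ℤ.m-n≡m⊖n (toℕ p) N) (ℤ.⊖-≥ N≤p))))
  (ℕ.m≤n+o⇒m∸n≤o _ N (Fin.toℕ≤pred[n] p))
... | inj₂ p≤N = subst (_≤ N)
  (sym (trans (cong ∣_∣ (ℤ.m-n≡m⊖n (toℕ p) N)) (ℤ.∣⊖∣-≤ p≤N)))
  (ℕ.m∸n≤m N (toℕ p))

centre-surjective : ∀ N z → ∣ z ∣ ≤ N → ∃ λ p → centre N p ≡ z
centre-surjective N (+ a) a≤N =
  fromℕ< (s≤s (ℕ.+-monoˡ-≤ N a≤N)) , (begin
    + toℕ (fromℕ< (s≤s (ℕ.+-monoˡ-≤ N a≤N))) ℤ.- + N ≡⟨ cong (λ m → + m ℤ.- + N) (Fin.toℕ-fromℕ< _) ⟩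
    + (a + N) ℤ.- + N       ≡⟨ cong (ℤ._- + N) (ℤ.pos-+ a N) ⟩
    + a ℤ.+ + N ℤ.- + N     ≡⟨ cancel (+ a) (+ N) ⟩
    + a                     ∎)
  where
  open ≡-Reasoning
  cancel : ∀ a n → a ℤ.+ n ℤ.- n ≡ a
  cancel = ℤ-Solver.solve-∀
centre-surjective N -[1+ a ] a<N =
  fromℕ< N∸a< , (begin
    + toℕ (fromℕ< N∸a<) ℤ.- + N ≡⟨ cong (λ m → + m ℤ.- + N) (Fin.toℕ-fromℕ< N∸a<) ⟩
    + (N ∸ suc a) ℤ.- + N       ≡⟨ cong (ℤ._- + N) (ℤ.⊖-≥ a<N) ⟨
    (N ℤ.⊖ suc a) ℤ.- + N       ≡⟨ cong (ℤ._- + N) (ℤ.m-n≡m⊖n N (suc a)) ⟨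
    + N ℤ.- + suc a ℤ.- + N     ≡⟨ cancel (+ suc a) (+ N) ⟩
    -[1+ a ]                    ∎)
  where
  open ≡-Reasoning
  N∸a< : N ∸ suc a < suc (N + N)
  N∸a< = s≤s (ℕ.≤-trans (ℕ.m∸n≤m N (suc a)) (ℕ.m≤m+n N N))
  cancel : ∀ a n → n ℤ.- a ℤ.- n ≡ ℤ.- a
  cancel = ℤ-Solver.solve-∀

independent? : ∀ N (F : Vector (Vector ℤ d) k) → Independent N F ⊎ Dependent N F
independent? {d} {k} N F with Fin.any? {suc (N + N) ^ k} (λ p →
  Fin.all? (λ l → ⟨ centre N ∘ finToFun p , (λ i → F i l) ⟩ ℤ.≟ 0ℤ) ×-dec
  Fin.any? (λ i → ¬? (centre N (finToFun p i) ℤ.≟ 0ℤ)))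
... | yes (p , rel , μ≢0) = inj₂
  (centre N ∘ finToFun p , (λ i → ∣centre∣≤ N (finToFun p i)) , rel , μ≢0)
-- The failed search refutes `μ i ≢ 0ℤ`; decidability of equality turns this into `μ i ≡ 0ℤ`.
... | no none = inj₁ λ μ μ≤N rel i → decidable-stable (μ i ℤ.≟ 0ℤ) λ μi≢0 →
  let t : Fin k → Fin (suc (N + N))
      t i = proj₁ (centre-surjective N (μ i) (μ≤N i))
      decode : centre N ∘ finToFun (funToFin t) ≗ μ
      decode i = trans (cong (centre N) (Fin.finToFun-funToFin t i))
        (proj₂ (centre-surjective N (μ i) (μ≤N i)))
  in none ( funToFin t
          , (λ l → trans (⟨⟩-congˡ (λ i → F i l) decode) (rel l))
          , i , λ eq → μi≢0 (trans (sym (decode i)) eq))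

relation-apply : (F : Vector (Vector ℤ d) k) (μ : Vector ℤ k) → Relation F μ →
                 ∀ x → ⟨ μ , (λ i → ⟨ F i , x ⟩) ⟩ ≡ 0ℤ
relation-apply F μ rel x = trans (⟨⟩-assoc μ F x) (trans (⟨⟩-congˡ x rel) (⟨⟩-zeroˡ x))

-- A zero head coefficient would leave a bounded relation of `F` alone, and independence would make
-- all other coefficients vanish too.
head≢0 : ∀ {N} {a : Vector ℤ d} {F : Vector (Vector ℤ d) k} → Independent N F →
         ((μ , _) : Dependent N (a Vector.∷ F)) → μ zero ≢ 0ℤ
head≢0 {a = a} {F} indep (μ , μ≤N , rel , i , μi≢0) μ₀≡0 = μi≢0 (μ≡0 i)
  where
  tail-rel : Relation F (μ ∘ suc)
  tail-rel l = begin
    ⟨ μ ∘ suc , (λ i → F i l) ⟩                       ≡⟨ ℤ.+-identityˡ _ ⟨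
    0ℤ ℤ.+ ⟨ μ ∘ suc , (λ i → F i l) ⟩
      ≡⟨ cong (λ z → z ℤ.* a l ℤ.+ ⟨ μ ∘ suc , (λ i → F i l) ⟩) μ₀≡0 ⟨
    μ zero ℤ.* a l ℤ.+ ⟨ μ ∘ suc , (λ i → F i l) ⟩    ≡⟨ rel l ⟩
    0ℤ                                                ∎
    where open ≡-Reasoning
  μ≡0 : ∀ i → μ i ≡ 0ℤ
  μ≡0 zero    = μ₀≡0
  μ≡0 (suc i) = indep (μ ∘ suc) (μ≤N ∘ suc) tail-rel i

-- Evaluated at `v`, the relation keeps only its head term, whose coefficient is nonzero.
dependent-kernel : ∀ {N} {a : Vector ℤ d} {F : Vector (Vector ℤ d) k} →
                   Independent N F → Dependent N (a Vector.∷ F) →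
                   ∀ v → (∀ i → ⟨ F i , v ⟩ ≡ 0ℤ) → ⟨ a , v ⟩ ≡ 0ℤ
dependent-kernel {a = a} {F} indep dep@(μ , _ , rel , _) v Fv≡0 =
  Sum.[ (λ μ₀≡0 → contradiction μ₀≡0 (head≢0 indep dep)) , id ]
    (ℤ.i*j≡0⇒i≡0∨j≡0 (μ zero) (begin
      μ zero ℤ.* ⟨ a , v ⟩
        ≡⟨ ℤ.+-identityʳ _ ⟨
      μ zero ℤ.* ⟨ a , v ⟩ ℤ.+ 0ℤ
        ≡⟨ cong (ℤ._+_ (μ zero ℤ.* ⟨ a , v ⟩)) (⟨⟩-zeroʳ (μ ∘ suc)) ⟨
      μ zero ℤ.* ⟨ a , v ⟩ ℤ.+ ⟨ μ ∘ suc , (λ _ → 0ℤ) ⟩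
        ≡⟨ cong (ℤ._+_ (μ zero ℤ.* ⟨ a , v ⟩)) (⟨⟩-congʳ (μ ∘ suc) Fv≡0) ⟨
      μ zero ℤ.* ⟨ a , v ⟩ ℤ.+ ⟨ μ ∘ suc , (λ i → ⟨ F i , v ⟩) ⟩
        ≡⟨ relation-apply (a Vector.∷ F) μ rel v ⟩
      0ℤ ∎))
  where open ≡-Reasoning

-- Greedy selection: a near row enters `F` unless it has a bounded relation with `F`, in which case
-- it vanishes wherever `F` does; far rows are passed over. The selection stops once `d` rows are
-- found.
basis : ∀ N (P : Vector ℤ d → Set) {A : Set} (row : A → Vector ℤ d) {Far : A → Set} →
        0 < d → ∀ {as} → All (λ a → P (row a) ⊎ Far a) as →
        (∃ λ (F : Vector (Vector ℤ d) d) → (∀ i → P (F i)) × Independent N F)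
        ⊎
        (∃₂ λ k (F : Vector (Vector ℤ d) k) →
          k < d × (∀ i → P (F i)) × Independent N F ×
          (∀ v → (∀ i → ⟨ F i , v ⟩ ≡ 0ℤ) → All (λ a → ⟨ row a , v ⟩ ≡ 0ℤ ⊎ Far a) as))
basis N P row 0<d [] = inj₂ (0 , (λ ()) , 0<d , (λ ()) , (λ _ _ _ ()) , λ _ _ → [])
basis {d} N P row 0<d {a ∷ _} (pa ∷ pas) with basis N P row 0<d pas | pa
... | inj₁ full | _ = inj₁ full
... | inj₂ (k , F , k<d , PF , indep , spans) | inj₂ far =
  inj₂ (k , F , k<d , PF , indep , λ v Fv≡0 → inj₂ far ∷ spans v Fv≡0)
... | inj₂ (k , F , k<d , PF , indep , spans) | inj₁ near with independent? N (row a Vector.∷ F)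
...   | inj₂ dep = inj₂ (k , F , k<d , PF , indep , λ v Fv≡0 →
        inj₁ (dependent-kernel indep dep v Fv≡0) ∷ spans v Fv≡0)
...   | inj₁ indep′ with ℕ.m≤n⇒m<n∨m≡n k<d
...     | inj₂ refl  = inj₁ (row a Vector.∷ F , Fin.∀-cons near PF , indep′)
...     | inj₁ 1+k<d = inj₂ (suc k , row a Vector.∷ F , 1+k<d , Fin.∀-cons near PF , indep′ ,
          λ v Fv≡0 → inj₁ (Fv≡0 zero) ∷ spans v (Fv≡0 ∘ suc))

-- Evaluated at `x`, the relation expresses `μ zero ℤ.* x j` through the `k` values `⟨ F i , x ⟩`,
-- and the nonzero integer factor cannot decrease `∣ x j ∣`.
coordinate-bound : ∀ {N} C (F : Vector (Vector ℤ d) k) (x : Vector ℤ d) →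
                   (∀ i → ∣ ⟨ F i , x ⟩ ∣ ≤ C) → Independent N F →
                   ∀ j → Dependent N (unit j Vector.∷ F) →
                   ∣ x j ∣ ≤ k * (N * C)
coordinate-bound {k = k} {N} C F x Fx≤C indep j dep@(μ , μ≤N , rel , _) = begin
  ∣ x j ∣                 ≤⟨ ℕ.m≤n*m ∣ x j ∣ ∣ μ zero ∣ {{∣μ₀∣≢0}} ⟩
  ∣ μ zero ∣ * ∣ x j ∣    ≡⟨ ℤ.∣i*j∣≡∣i∣*∣j∣ (μ zero) (x j) ⟨
  ∣ μ zero ℤ.* x j ∣      ≡⟨ cong ∣_∣ solve-x ⟩
  ∣ ℤ.- rest ∣            ≡⟨ ℤ.∣-i∣≡∣i∣ rest ⟩
  ∣ rest ∣                ≤⟨ ∣⟨⟩∣≤ (μ ∘ suc) (λ i → ⟨ F i , x ⟩) _ term≤ ⟩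
  k * (N * C)             ∎
  where
  open ℕ.≤-Reasoning

  ∣μ₀∣≢0 : NonZero ∣ μ zero ∣
  ∣μ₀∣≢0 = ℕ.≢-nonZero (head≢0 indep dep ∘ ℤ.∣i∣≡0⇒i≡0)

  rest = ⟨ μ ∘ suc , (λ i → ⟨ F i , x ⟩) ⟩

  term≤ : ∀ i → ∣ μ (suc i) ∣ * ∣ ⟨ F i , x ⟩ ∣ ≤ N * C
  term≤ i = ℕ.*-mono-≤ (μ≤N (suc i)) (Fx≤C i)

  i+j≡0⇒i≡-j : ∀ i j → i ℤ.+ j ≡ 0ℤ → i ≡ ℤ.- j
  i+j≡0⇒i≡-j i j eq = ℤ.i-j≡0⇒i≡j i (ℤ.- j) (trans (cong (ℤ._+_ i) (ℤ.neg-involutive j)) eq)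

  solve-x : μ zero ℤ.* x j ≡ ℤ.- rest
  solve-x = trans (cong (μ zero ℤ.*_) (sym (⟨unit,⟩ j x)))
    (i+j≡0⇒i≡-j _ _ (relation-apply (unit j Vector.∷ F) μ rel x))

-- `suc d` vectors with `d` coordinates: `siegel` is applied to the columns of their matrix. To the
-- norm of a column, `unit j` contributes at most 1 and `F` at most `d * s`.
unit-dependent : ∀ s (F : Vector (Vector ℤ d) d) → (∀ i l → ∣ F i l ∣ ≤ s) →
                 ∀ j → Dependent (suc (d * s) ^ d) (unit j Vector.∷ F)
unit-dependent {d} s F F≤s j = dependent (siegel (suc (d * s)) (ℕ.n<1+n d) columns columns≤)
  where
  columns : Vector (Vector ℤ (suc d)) d
  columns l i = (unit j Vector.∷ F) i l

  columns≤ : ∀ l → ‖ columns l ‖₁ ≤ suc (d * s)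
  columns≤ l = ℕ.+-mono-≤ (∣unit∣≤1 j l) (‖‖₁-≤ (λ i → F i l) s (λ i → F≤s i l))

  dependent : _ → Dependent (suc (d * s) ^ d) (unit j Vector.∷ F)
  dependent (v , v≢0 , rel , v≤N) = v , v≤N , (λ l → trans (⟨⟩-comm v (columns l)) (rel l)) , v≢0

-- Steps preserving all constraints

infixl 6 _⊕_

_⊕_ : Vector ℤ d → Vector ℤ d → Vector ℤ d
(x ⊕ u) i = x i ℤ.+ u i

-- Divisibility constraints are insensitive to the steps used below, so
-- they get the zero row.
row : Constraint d → Vector ℤ d
row (equality α _)       = α
row (inequality α _)     = α
row (divisibility _ _ _) = λ _ → 0ℤ

rhs : Constraint d → ℤ
rhs (equality _ c)       = c
rhs (inequality _ c)     = c
rhs (divisibility _ _ _) = 0ℤ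

gap : Vector ℤ d → Constraint d → ℤ
gap x a = ⟨ row a , x ⟩ ℤ.- rhs a

-- A change of the gap by zero, or by less than its absolute value, neither creates nor removes a
-- zero and does not flip the sign.
Harmless : Vector ℤ d → Vector ℤ d → Constraint d → Set
Harmless x u a = ⟨ row a , u ⟩ ≡ 0ℤ ⊎ ∣ ⟨ row a , u ⟩ ∣ < ∣ gap x a ∣

zero-preserved : ∀ t z → z ≡ 0ℤ ⊎ ∣ z ∣ < ∣ t ∣ → t ≡ 0ℤ ⇔ t ℤ.+ z ≡ 0ℤ
zero-preserved t z (inj₁ refl) = mk⇔ (trans (ℤ.+-identityʳ t)) (trans (sym (ℤ.+-identityʳ t)))
zero-preserved t z (inj₂ z<t) = mk⇔
  (λ { refl → contradiction z<t λ () })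
  (λ t+z≡0 → contradiction z<t (ℕ.<-irrefl (trans (sym (ℤ.∣-i∣≡∣i∣ z)) (cong ∣_∣ (sym
    (ℤ.i-j≡0⇒i≡j t (ℤ.- z) (trans (cong (ℤ._+_ t) (ℤ.neg-involutive z)) t+z≡0)))))))

sign-preserved : ∀ t z → z ≡ 0ℤ ⊎ ∣ z ∣ < ∣ t ∣ → 0ℤ ℤ.≤ t ⇔ 0ℤ ℤ.≤ t ℤ.+ z
sign-preserved t z (inj₁ refl) =
  subst (λ w → 0ℤ ℤ.≤ t ⇔ 0ℤ ℤ.≤ w) (sym (ℤ.+-identityʳ t)) (Identity.⇔-id _)
sign-preserved (+ m) (+ n) (inj₂ _) = mk⇔ (λ _ → +≤+ z≤n) (λ _ → +≤+ z≤n)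
sign-preserved (+ m) -[1+ n ] (inj₂ n<m) = mk⇔
  (λ _ → subst (0ℤ ℤ.≤_) (sym (ℤ.⊖-≥ (ℕ.<⇒≤ n<m))) (+≤+ z≤n)) (λ _ → +≤+ z≤n)
sign-preserved -[1+ m ] (+ n) (inj₂ (s≤s n≤m)) = mk⇔ (λ ())
  (λ 0≤ → contradiction (subst (0ℤ ℤ.≤_)
    (trans (ℤ.⊖-< (s≤s n≤m)) (cong (λ w → ℤ.- + w) (ℕ.+-∸-assoc 1 n≤m))) 0≤) λ ())
sign-preserved -[1+ m ] -[1+ n ] (inj₂ _) = mk⇔ (λ ()) (λ ())

gap-⊕ : ∀ (x u : Vector ℤ d) a → gap (x ⊕ u) a ≡ gap x a ℤ.+ ⟨ row a , u ⟩
gap-⊕ x u a = trans (cong (ℤ._- rhs a) (⟨⟩-+ (row a) x u))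
  (swap ⟨ row a , x ⟩ ⟨ row a , u ⟩ (rhs a))
  where
  swap : ∀ i j c → i ℤ.+ j ℤ.- c ≡ i ℤ.- c ℤ.+ j
  swap = ℤ-Solver.solve-∀

∣⟨⟩ : ∀ {c} (α u : Vector ℤ d) → (∀ l → c ∣ℤ u l) → c ∣ℤ ⟨ α , u ⟩
∣⟨⟩ {zero}  α u c∣u = Signed.divides 0ℤ refl
∣⟨⟩ {suc d} α u c∣u = Signed.∣m∣n⇒∣m+n (Signed.∣n⇒∣m*n (α zero) (c∣u zero))
  (∣⟨⟩ (α ∘ suc) (u ∘ suc) (c∣u ∘ suc))

-- Equality and inequality constraints depend only on whether the gap is zero or nonnegative. The
-- modulus of a divisibility constraint divides `L`, hence every entry of `u`.
holds-⊕ : ∀ {L} (x u : Vector ℤ d) a → ModulusDivides L a → (∀ l → + L ∣ℤ u l) →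
          Harmless x u a → Holds x a ⇔ Holds (x ⊕ u) a
holds-⊕ x u a@(equality α c) _ _ harmless = mk⇔
  (λ eq → ℤ.i-j≡0⇒i≡j _ c (trans (gap-⊕ x u a) (to gap≡0 (ℤ.i≡j⇒i-j≡0 eq))))
  (λ eq → ℤ.i-j≡0⇒i≡j _ c (from gap≡0 (trans (sym (gap-⊕ x u a)) (ℤ.i≡j⇒i-j≡0 eq))))
  where gap≡0 = zero-preserved (gap x a) ⟨ α , u ⟩ harmless
holds-⊕ x u a@(inequality α c) _ _ harmless = mk⇔
  (λ le → ℤ.0≤i-j⇒j≤i (subst (0ℤ ℤ.≤_) (sym (gap-⊕ x u a)) (to 0≤gap (ℤ.i≤j⇒0≤j-i le))))
  (λ le → ℤ.0≤i-j⇒j≤i (from 0≤gap (subst (0ℤ ℤ.≤_) (gap-⊕ x u a) (ℤ.i≤j⇒0≤j-i le))))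
  where 0≤gap = sign-preserved (gap x a) ⟨ α , u ⟩ harmless
holds-⊕ {L = L} x u (divisibility m α c) m∣L L∣u _ = mk⇔
  (λ m∣ → subst (+ m ∣ℤ_) (sym split) (Signed.∣m∣n⇒∣m+n m∣ m∣αu))
  (λ m∣ → Signed.∣m+n∣n⇒∣m (subst (+ m ∣ℤ_) split m∣) m∣αu)
  where
  β = +_ ∘ toℕ ∘ α
  m∣αu : + m ∣ℤ ⟨ β , u ⟩
  m∣αu = Signed.∣-trans (Signed.∣ᵤ⇒∣ m∣L) (∣⟨⟩ β u L∣u)
  split : ⟨ β , x ⊕ u ⟩ ℤ.- + toℕ c ≡ ⟨ β , x ⟩ ℤ.- + toℕ c ℤ.+ ⟨ β , u ⟩
  -- The divisibility constraint itself has the zero row, so an equality constraint with its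
  -- coefficients is passed instead.
  split = gap-⊕ x u (equality β (+ toℕ c))

-- Negation reverses implications, so the atoms have to be equivalent and not merely preserved.
⊨-cong : ∀ {x y : Vector ℤ d} (S : System d) →
         All (λ a → Holds x a ⇔ Holds y a) (constraints S) → (x ⊨ S) ⇔ (y ⊨ S)
⊨-cong (atom a) (eq ∷ []) = eq
⊨-cong ⊤′ _ = Identity.⇔-id _
⊨-cong ⊥′ _ = Identity.⇔-id _
⊨-cong (¬′ S) eqs = mk⇔ (λ ¬x → ¬x ∘ from (⊨-cong S eqs)) (λ ¬y → ¬y ∘ to (⊨-cong S eqs))
⊨-cong (S ∧′ T) eqs with eqS , eqT ← All.++⁻ (constraints S) eqs =
  mk⇔ (λ (p , q) → to (⊨-cong S eqS) p , to (⊨-cong T eqT) q)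
      (λ (p , q) → from (⊨-cong S eqS) p , from (⊨-cong T eqT) q)
⊨-cong (S ∨′ T) eqs with eqS , eqT ← All.++⁻ (constraints S) eqs =
  mk⇔ (Sum.map (to (⊨-cong S eqS)) (to (⊨-cong T eqT)))
      (Sum.map (from (⊨-cong S eqS)) (from (⊨-cong T eqT)))

⊨-⊕ : ∀ {L} (S : System d) (x u : Vector ℤ d) → All (ModulusDivides L) (constraints S) →
      (∀ l → + L ∣ℤ u l) → All (Harmless x u) (constraints S) → x ⊨ S → x ⊕ u ⊨ S
⊨-⊕ S x u L-ok L∣u harmless =
  to (⊨-cong S (All.zipWith (λ {a} (m , h) → holds-⊕ x u a m L∣u h) (L-ok , harmless)))

-- The lexicographic order on absolute values

infix 4 _≺_

_≺_ : Vector ℤ d → Vector ℤ d → Set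
x ≺ y = Lex-< _≡_ _<_ (Vector.toVec (∣_∣ ∘ x)) (Vector.toVec (∣_∣ ∘ y))

≺-wellFounded : WellFounded (_≺_ {d})
≺-wellFounded = On.wellFounded (λ x → Vector.toVec (∣_∣ ∘ x))
  (Lex.<-wellFounded trans (λ { refl → id }) ℕ.<-wellFounded)

∣⊖∣< : ∀ {m n} → 0 < n → n ≤ m → ∣ m ℤ.⊖ n ∣ < m
∣⊖∣< {m} {n} 0<n n≤m = subst (_< m) (cong ∣_∣ (sym (ℤ.⊖-≥ n≤m))) (ℕ.∸-monoʳ-< 0<n n≤m)

-- Moving against the sign of `a` by less than `∣ a ∣` approaches zero without crossing it; the
-- signs of `a` and `b` choose between sum and difference.
shrink : ∀ a b → b ≢ 0ℤ → ∣ b ∣ < ∣ a ∣ → ∣ a ℤ.+ b ∣ < ∣ a ∣ ⊎ ∣ a ℤ.- b ∣ < ∣ a ∣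
shrink _        (+ 0)     b≢0 _   = contradiction refl b≢0
shrink (+ m)    (+ suc n) _   n<m = inj₂ (∣⊖∣< (s≤s z≤n) (ℕ.<⇒≤ n<m))
shrink (+ m)    -[1+ n ]  _   n<m = inj₁ (∣⊖∣< (s≤s z≤n) (ℕ.<⇒≤ n<m))
shrink -[1+ m ] (+ suc n) _   n<m = inj₁ (subst (_< suc m) (ℤ.∣m⊖n∣≡∣n⊖m∣ (suc m) (suc n))
  (∣⊖∣< (s≤s z≤n) (ℕ.<⇒≤ n<m)))
shrink -[1+ m ] -[1+ n ]  _   n<m = inj₂ (subst (_< suc m) (ℤ.∣m⊖n∣≡∣n⊖m∣ (suc m) (suc n))
  (∣⊖∣< (s≤s z≤n) (ℕ.<⇒≤ n<m)))

-- The first nonzero coordinate of `u` decides: earlier ones stay fixed, this one shrinks for one of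
-- the two signs, and later ones may grow.
≺-step : (x u : Vector ℤ d) → (∃ λ j → u j ≢ 0ℤ) → (∀ j → u j ≡ 0ℤ ⊎ ∣ u j ∣ < ∣ x j ∣) →
         x ⊕ u ≺ x ⊎ x ⊕ (ℤ.-_ ∘ u) ≺ x
≺-step {suc d} x u (j , uj≢0) small with u zero ℤ.≟ 0ℤ | small zero
... | no u₀≢0 | inj₁ u₀≡0 = contradiction u₀≡0 u₀≢0
... | no u₀≢0 | inj₂ u₀<x₀ = Sum.map (λ lt → this lt refl) (λ lt → this lt refl)
  (shrink (x zero) (u zero) u₀≢0 u₀<x₀)
... | yes u₀≡0 | _ with j
...   | zero  = contradiction u₀≡0 uj≢0
...   | suc j = Sum.map
  (next (cong ∣_∣ (trans (cong (ℤ._+_ (x zero)) u₀≡0) (ℤ.+-identityʳ (x zero)))))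
  (next (cong ∣_∣ (trans (cong (ℤ._-_ (x zero)) u₀≡0) (ℤ.+-identityʳ (x zero)))))
  (≺-step (x ∘ suc) (u ∘ suc) (j , uj≢0) (small ∘ suc))

-- Descent to a solution with bounded coordinates

axis : Fin d → Constraint d
axis j = inequality (unit j) 0ℤ

SmallRow : ℕ → Constraint d → Set
SmallRow s a = (∀ l → ∣ row a l ∣ ≤ s) × ∣ rhs a ∣ ≤ s

smallRow : ∀ {s} (a : Constraint d) → BoundedBy s a → SmallRow s a
smallRow (equality α c) le =
  (λ l → ℕ.≤-trans (lookup≤‖‖∞ α l) (ℕ.m⊔n≤o⇒m≤o ‖ α ‖∞ ∣ c ∣ le)) , ℕ.m⊔n≤o⇒n≤o ‖ α ‖∞ ∣ c ∣ le
smallRow (inequality α c) le =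
  (λ l → ℕ.≤-trans (lookup≤‖‖∞ α l) (ℕ.m⊔n≤o⇒m≤o ‖ α ‖∞ ∣ c ∣ le)) , ℕ.m⊔n≤o⇒n≤o ‖ α ‖∞ ∣ c ∣ le
smallRow (divisibility _ _ _) _ = (λ _ → z≤n) , z≤n

-- The rows unit j have entries bounded by s only if s ≠ 0; norm-zero below
-- covers s = 0.
module Descent (e : ℕ) (S : System (suc e)) (s L : ℕ) .{{_ : NonZero s}} .{{_ : NonZero L}}
               (S≤s : All (BoundedBy s) (constraints S))
               (S∣L : All (ModulusDivides L) (constraints S)) where

  -- `N` bounds the entries of the vectors `v` that `siegel` finds for at most `e` rows of 1-norm at
  -- most `d′ * s`; `θ` bounds the change of a pairing under `L v`. A gap of at most `θ` leaves a
  -- pairing of at most `C`, from which `coordinate-bound` makes `bound`.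
  d′ N θ C bound : ℕ
  d′    = suc e
  N     = (d′ * s) ^ e
  θ     = L * (d′ * (s * N))
  C     = θ + s
  bound = d′ * (suc (d′ * s) ^ d′ * C)

  candidates : List (Constraint d′)
  candidates = constraints S ++ List.tabulate axis

  smallRows : All (SmallRow s) candidates
  smallRows = All.++⁺ (All.map (λ {a} → smallRow a) S≤s)
    (All.tabulate⁺ {f = axis} (λ j → (λ l → ℕ.≤-trans (∣unit∣≤1 j l) (ℕ.>-nonZero⁻¹ s)) , z≤n))

  Near : Vector ℤ d′ → Vector ℤ d′ → Set
  Near x α = (∀ l → ∣ α l ∣ ≤ s) × ∣ ⟨ α , x ⟩ ∣ ≤ C

  Far : Vector ℤ d′ → Constraint d′ → Set
  Far x a = (∀ l → ∣ row a l ∣ ≤ s) × θ < ∣ gap x a ∣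

  near-or-far : ∀ x {a} → SmallRow s a → Near x (row a) ⊎ Far x a
  near-or-far x {a} (row≤s , rhs≤s) with ∣ gap x a ∣ ℕ.≤? θ
  ... | no gap≰θ  = inj₂ (row≤s , ℕ.≰⇒> gap≰θ)
  ... | yes gap≤θ = inj₁ (row≤s , subst (λ z → ∣ z ∣ ≤ C) (uncancel ⟨ row a , x ⟩ (rhs a))
          (ℕ.≤-trans (ℤ.∣i+j∣≤∣i∣+∣j∣ (gap x a) (rhs a)) (ℕ.+-mono-≤ gap≤θ rhs≤s)))
    where
    uncancel : ∀ i c → i ℤ.- c ℤ.+ c ≡ i
    uncancel = ℤ-Solver.solve-∀

  Step : Vector ℤ d′ → Vector ℤ d′ → Set
  Step x u = (∀ l → + L ∣ℤ u l) × All (Harmless x u) (constraints S) × x ⊕ u ≺ x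

  harmless-neg : ∀ x u {a : Constraint d′} → Harmless x u a → Harmless x (ℤ.-_ ∘ u) a
  harmless-neg x u {a} = Sum.map
    (λ eq → trans (⟨⟩-neg (row a) u) (cong ℤ.-_ eq))
    (subst (_< ∣ gap x a ∣) (trans (sym (ℤ.∣-i∣≡∣i∣ ⟨ row a , u ⟩))
      (cong ∣_∣ (sym (⟨⟩-neg (row a) u)))))

  step-of : ∀ x v → (∃ λ j → v j ≢ 0ℤ) → (∀ j → ∣ v j ∣ ≤ N) →
            All (λ a → ⟨ row a , v ⟩ ≡ 0ℤ ⊎ Far x a) candidates → ∃ (Step x)
  step-of x v (j , vj≢0) v≤N spans = Sum.[ forward , backward ]′
    (≺-step x u (j , uj≢0) coordinates)
    where
    u : Vector ℤ d′
    u l = + L ℤ.* v l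

    L∣u : ∀ l → + L ∣ℤ u l
    L∣u l = Signed.∣m⇒∣m*n (v l) Signed.∣-refl

    uj≢0 : u j ≢ 0ℤ
    uj≢0 eq = Sum.[ (λ L≡0 → ℕ.≢-nonZero⁻¹ L (ℤ.+-injective L≡0)) , vj≢0 ]
      (ℤ.i*j≡0⇒i≡0∨j≡0 (+ L) eq)

    harmless : ∀ {a} → ⟨ row a , v ⟩ ≡ 0ℤ ⊎ Far x a → Harmless x u a
    harmless {a} (inj₁ eq) = inj₁ (trans
      (⟨⟩-* (row a) (+ L) v)
      (trans (cong (+ L ℤ.*_) eq) (ℤ.*-zeroʳ (+ L))))
    harmless {a} (inj₂ (row≤s , θ<gap)) = inj₂ (ℕ.≤-<-trans (begin
      ∣ ⟨ row a , u ⟩ ∣         ≡⟨ cong ∣_∣ (⟨⟩-* (row a) (+ L) v) ⟩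
      ∣ + L ℤ.* ⟨ row a , v ⟩ ∣ ≡⟨ ℤ.∣i*j∣≡∣i∣*∣j∣ (+ L) ⟨ row a , v ⟩ ⟩
      L * ∣ ⟨ row a , v ⟩ ∣     ≤⟨ ℕ.*-monoʳ-≤ L (∣⟨⟩∣≤ (row a) v (s * N) λ l →
                                     ℕ.*-mono-≤ (row≤s l) (v≤N l)) ⟩
      θ                         ∎) θ<gap)
      where open ℕ.≤-Reasoning

    harmlessAll : All (Harmless x u) candidates
    harmlessAll = All.map (λ {a} → harmless {a}) spans

    harmlessS : All (Harmless x u) (constraints S)
    harmlessS = All.++⁻ˡ (constraints S) harmlessAll

    forward : x ⊕ u ≺ x → ∃ (Step x)
    forward lt = u , L∣u , harmlessS , lt

    backward : x ⊕ (ℤ.-_ ∘ u) ≺ x → ∃ (Step x)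
    backward lt = ℤ.-_ ∘ u , (λ l → Signed.∣m⇒∣-m (L∣u l)) ,
      All.map (λ {a} → harmless-neg x u {a}) harmlessS , lt

    coordinates : ∀ j → u j ≡ 0ℤ ⊎ ∣ u j ∣ < ∣ x j ∣
    -- The gap of `axis j` at `x` is `x j`, so harmlessness for this axis is what `≺-step` asks of
    -- coordinate `j`.
    coordinates j = Sum.map
      (trans (sym (⟨unit,⟩ j u)))
      (subst₂ (λ a b → ∣ a ∣ < ∣ b ∣) (⟨unit,⟩ j u) (trans (ℤ.+-identityʳ _) (⟨unit,⟩ j x)))
      (All.tabulate⁻ {f = axis} (All.++⁻ʳ (constraints S) harmlessAll) j)

  -- Either `d′` independent near rows bound every coordinate, or fewer rows have a short common
  -- kernel vector on which all near rows vanish, and it yields a step.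
  progress : ∀ x → (∀ j → ∣ x j ∣ ≤ bound) ⊎ ∃ (Step x)
  progress x = Sum.map bounded step
    (basis (suc (d′ * s) ^ d′) (Near x) row (s≤s z≤n)
      (All.map (λ {a} → near-or-far x {a}) smallRows))
    where
    bounded : _ → ∀ j → ∣ x j ∣ ≤ bound
    bounded (F , near , indep) j = coordinate-bound C F x (proj₂ ∘ near) indep j
      (unit-dependent s F (proj₁ ∘ near) j)

    step : _ → ∃ (Step x)
    step (k , F , k<d , near , _ , spans) = step′
      (siegel (d′ * s) {{ℕ.m*n≢0 d′ s}} k<d F (λ i → ‖‖₁-≤ (F i) s (proj₁ (near i))))
      where
      step′ : _ → ∃ (Step x)
      step′ (v , v≢0 , Fv≡0 , v≤) = step-of x v v≢0
        -- `k` is at most `e`, so the bound from `siegel` is at most `N`.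
        (λ j → ℕ.≤-trans (v≤ j) (ℕ.^-monoʳ-≤ (d′ * s) {{ℕ.m*n≢0 d′ s}} (ℕ.≤-pred k<d)))
        (spans v Fv≡0)

  descend : ∀ x → Acc _≺_ x → x ⊨ S → ∃ λ y → y ⊨ S × (∀ j → ∣ y j ∣ ≤ bound)
  descend x (acc rec) x⊨S = continue (progress x)
    where
    continue : (∀ j → ∣ x j ∣ ≤ bound) ⊎ ∃ (Step x) → ∃ λ y → y ⊨ S × (∀ j → ∣ y j ∣ ≤ bound)
    continue (inj₁ x≤)                        = x , x⊨S , x≤
    continue (inj₂ (u , L∣u , harmless , lt)) =
      descend (x ⊕ u) (rec lt) (⊨-⊕ S x u S∣L L∣u harmless x⊨S)

-- Nonzero lcm, systems of norm zero, and the final estimate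

lcm≢0 : ∀ m n .{{_ : NonZero m}} .{{_ : NonZero n}} → NonZero (ℕ.lcm m n)
lcm≢0 m n = ℕ.≢-nonZero λ lcm≡0 → ℕ.≢-nonZero⁻¹ (m * n) {{ℕ.m*n≢0 m n}}
  (ℕ.0∣⇒≡0 (subst (ℕ._∣ m * n) lcm≡0 (ℕ.lcm-least (ℕ.m∣m*n {m} n) (ℕ.n∣m*n m {n}))))

lcm-nonZero : (S : System d) → NonZero (lcm S)
lcm-nonZero S = go (constraints S)
  where
  modulus≢0 : (a : Constraint d) → NonZero (modulus a)
  modulus≢0 (equality _ _)                 = _
  modulus≢0 (inequality _ _)               = _
  -- The stored proof is irrelevant, so a relevant one is rebuilt through `m ≢ 0`.
  modulus≢0 (divisibility m {{m≢0}} _ _)   = ℕ.≢-nonZero (ℕ.≢-nonZero⁻¹ m {{m≢0}})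

  go : (as : List (Constraint d)) → NonZero (List.foldr ℕ.lcm 1 (List.map modulus as))
  go []       = _
  go (a ∷ as) = lcm≢0 (modulus a) _ {{modulus≢0 a}} {{go as}}

-- All rows vanish, so every step by multiples of `L` is harmless, in particular reduction of each
-- coordinate modulo `L`.
norm-zero : (S : System d) (L : ℕ) .{{_ : NonZero L}} → All (BoundedBy 0) (constraints S) →
            All (ModulusDivides L) (constraints S) → ∀ x → x ⊨ S →
            ∃ λ y → y ⊨ S × (∀ j → ∣ y j ∣ ≤ L)
norm-zero {d} S L S≤0 S∣L x x⊨S =
  x ⊕ u , ⊨-⊕ S x u S∣L (λ l → Signed.∣n⇒∣m*n (ℤ.- (x l ℤ./ℕ L)) Signed.∣-refl)
                (All.map (λ {a} → harmless a) S≤0) x⊨S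
        , λ j → subst (λ z → ∣ z ∣ ≤ L) (sym (remainder j)) (ℕ.<⇒≤ (ℤ.n%ℕd<d (x j) L))
  where
  u : Vector ℤ d
  u l = ℤ.- (x l ℤ./ℕ L) ℤ.* + L

  remainder : ∀ j → (x ⊕ u) j ≡ + (x j ℤ.%ℕ L)
  remainder j = trans (cong (ℤ._+ u j) (ℤ.a≡a%ℕn+[a/ℕn]*n (x j) L))
    (cancel (+ (x j ℤ.%ℕ L)) (x j ℤ./ℕ L) (+ L))
    where
    cancel : ∀ r q l → r ℤ.+ q ℤ.* l ℤ.+ (ℤ.- q) ℤ.* l ≡ r
    cancel = ℤ-Solver.solve-∀

  harmless : ∀ a → BoundedBy 0 a → Harmless x u a
  harmless a a≤0 = inj₁ (trans
    (⟨⟩-congˡ {α = row a} u (λ l → ℤ.∣i∣≡0⇒i≡0 (ℕ.n≤0⇒n≡0 (proj₁ (smallRow a a≤0) l))))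
    (⟨⟩-zeroˡ u))

-- The outermost factor `d` passes from coordinates to the 1-norm. Both `suc (d * s)` and
-- `suc (d ^ 2)` are at most the base `Q` of the target power, and the exponents `d` and `suc d` add
-- up to `2 * d + 1`.
bound-arithmetic : ∀ e s L .{{_ : NonZero s}} .{{_ : NonZero L}} → let d = suc e in
  d * (d * (suc (d * s) ^ d * (L * (d * (s * (d * s) ^ e)) + s)))
    ≤ L * (d + (2 + d + d ^ 2 * s) ^ (2 * d + 1))
bound-arithmetic e s L = begin
  d′ * (d′ * (N′ * (L * (d′ * (s * (d′ * s) ^ e)) + s)))
    -- Enlarging `s` to `L * s` lets `L` be factored out.
    ≤⟨ ℕ.*-monoʳ-≤ d′ (ℕ.*-monoʳ-≤ d′ (ℕ.*-monoʳ-≤ N′ (ℕ.+-monoʳ-≤ _ (ℕ.m≤n*m s L)))) ⟩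
  d′ * (d′ * (N′ * (L * (d′ * (s * (d′ * s) ^ e)) + L * s)))
    ≡⟨ collect d′ N′ L s ((d′ * s) ^ e) ⟩
  L * (N′ * (d′ ^ 2 * (d′ * s) ^ d′ + d′ ^ 2 * s))
    ≤⟨ ℕ.*-monoʳ-≤ L (ℕ.*-mono-≤ (ℕ.^-monoˡ-≤ d′ 1+ds≤Q)
        (ℕ.+-mono-≤ (ℕ.*-monoʳ-≤ (d′ ^ 2) (ℕ.^-monoˡ-≤ d′ (ℕ.m+n≤o⇒n≤o 1 1+ds≤Q))) d²s≤Q^d′)) ⟩
  L * (Q ^ d′ * (d′ ^ 2 * Q ^ d′ + Q ^ d′))
    ≡⟨ cong (λ z → L * (Q ^ d′ * z)) (ℕ.+-comm (d′ ^ 2 * Q ^ d′) (Q ^ d′)) ⟩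
  L * (Q ^ d′ * (suc (d′ ^ 2) * Q ^ d′))
    ≤⟨ ℕ.*-monoʳ-≤ L (ℕ.*-monoʳ-≤ (Q ^ d′) (ℕ.*-monoˡ-≤ (Q ^ d′) 1+d²≤Q)) ⟩
  L * (Q ^ d′ * (Q ^ suc d′))
    ≡⟨ cong (L *_) (ℕ.^-distribˡ-+-* Q d′ (suc d′)) ⟨
  L * Q ^ (d′ + suc d′)
    ≡⟨ cong (λ z → L * Q ^ z) (exponent d′) ⟩
  L * Q ^ (2 * d′ + 1)
    ≤⟨ ℕ.*-monoʳ-≤ L (ℕ.m≤n+m _ d′) ⟩
  L * (d′ + Q ^ (2 * d′ + 1)) ∎
  where
  open ℕ.≤-Reasoning
  d′  = suc e
  N′ = suc (d′ * s) ^ d′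
  Q  = 2 + d′ + d′ ^ 2 * s

  collect : ∀ d n l s p → d * (d * (n * (l * (d * (s * p)) + l * s)))
                          ≡ l * (n * (d * (d * 1) * (d * s * p) + d * (d * 1) * s))
  collect = ℕ-Solver.solve-∀

  exponent : ∀ d → d + suc d ≡ 2 * d + 1
  exponent = ℕ-Solver.solve-∀

  d≤d² : d′ ≤ d′ ^ 2
  d≤d² = ℕ.m≤m*n d′ (d′ * 1)

  1+ds≤Q : suc (d′ * s) ≤ Q
  1+ds≤Q = ℕ.+-mono-≤ {1} {2 + d′} (s≤s z≤n) (ℕ.*-monoˡ-≤ s d≤d²)

  d²s≤Q^d′ : d′ ^ 2 * s ≤ Q ^ d′
  d²s≤Q^d′ = ℕ.≤-trans (ℕ.m≤n+m (d′ ^ 2 * s) (2 + d′)) (ℕ.m≤m*n Q (Q ^ e) {{ℕ.m^n≢0 Q e}})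

  1+d²≤Q : suc (d′ ^ 2) ≤ Q
  1+d²≤Q = ℕ.+-mono-≤ {1} {2 + d′} (s≤s z≤n) (ℕ.m≤m*n (d′ ^ 2) s)

theorem2 : ∀ (d : ℕ) (S : System d) → Satisfiable S →
    ∃ λ (x : Vector ℤ d) → (x ⊨ S) × (‖ x ‖₁ ≤ lcm S * (d + (2 + d + d ^ 2 * ‖ S ‖) ^ (2 * d + 1)))
theorem2 zero    S (x , x⊨S) = x , x⊨S , z≤n
theorem2 (suc e) S (x , x⊨S) = bounded ‖ S ‖ refl
  where
  d′ = suc e
  L = lcm S
  instance _ = lcm-nonZero S

  S∣L : All (ModulusDivides L) (constraints S)
  S∣L = to (lcm-least S L) ℕ.∣-refl

  -- Naming the norm `s` permits a case split; the successor case supplies the `NonZero s` for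
  -- `Descent`.
  bounded : ∀ s → ‖ S ‖ ≡ s →
            ∃ λ y → y ⊨ S × ‖ y ‖₁ ≤ L * (d′ + (2 + d′ + d′ ^ 2 * s) ^ (2 * d′ + 1))
  bounded zero eq =
    let y , y⊨S , y≤L = norm-zero S L (to (‖‖-least S 0) (ℕ.≤-reflexive eq)) S∣L x x⊨S
    -- The 1-norm is at most `d′ * L`, which the summand `d′` of the bound covers.
    in y , y⊨S , ℕ.≤-trans (‖‖₁-≤ y L y≤L)
                   (ℕ.≤-trans (ℕ.≤-reflexive (ℕ.*-comm d′ L)) (ℕ.*-monoʳ-≤ L (ℕ.m≤m+n d′ _)))
  bounded s@(suc _) eq =
    let open Descent e S s L (to (‖‖-least S s) (ℕ.≤-reflexive eq)) S∣L
        y , y⊨S , y≤ = descend x (≺-wellFounded x) x⊨S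
    in y , y⊨S , ℕ.≤-trans (‖‖₁-≤ y bound y≤) (bound-arithmetic e s L)
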